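{- Let $k\ge 1$ and $n\ge 1$ be integers and let $K_n$ be the complete graph on $n$ vertices. If the vertices of $K_n$ are colored uniformly and independently with $k$ colors, the expected number of blocks is $$\mathbb{E}[X_k(K_n)]=k-\frac{(k-1)^n}{k^{n-1}}.$$
   Context: Given a coloring of the vertices of a finite graph $G$ with $k$ colors, the blocks are the connected components of the subgraph of $G$ formed by all vertices and all edges whose two endpoints have the same color. $X_k(G)$ denotes the number of blocks when each vertex of $G$ receives independently a uniformly random color among $k$ colors. -}

module Defs where

open import Data.Bool.Properties using () renaming (_≟_ to _≟ᵇ_)
open import Data.Fin.Base using (Fin)
open import Data.Fin.Properties using () renaming (_≟_ to _≟ᶠ_)
open import Data.Fin.Subset using (Subset)
open import Data.Integer.Base using (+_; 1ℤ)
open import Data.List.Base using (List; []; _∷_; map; foldr; length; allFin; cartesianProductWith; deduplicate)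
open import Data.List.Membership.Propositional using (_∈_)
open import Data.List.Membership.Propositional.Properties using (∈-allFin)
open import Data.List.Relation.Unary.Any using (here; there)
open import Data.Nat.Base using (ℕ; zero; suc; NonZero)
open import Data.Product.Base using (_×_; _,_; proj₁; proj₂)
open import Data.Rational.Base using (ℚ; 0ℚ; 1ℚ; _+_; _*_; _/_)
open import Data.Sum.Base using (_⊎_; inj₁; inj₂; [_,_])
open import Data.Vec.Base as Vec using (Vec; lookup; tabulate)
open import Data.Vec.Properties using () renaming (≡-dec to ≡-decᵛ)
open import Function.Base using (id; _∘_)
open import Level using (0ℓ)
open import Relation.Binary.Construct.Closure.ReflexiveTransitive using (Star; ε; _◅_; _◅◅_)
open import Relation.Binary.Core using (Rel)
open import Relation.Binary.Definitions using (Decidable; Symmetric)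
open import Relation.Binary.PropositionalEquality.Core using (_≡_; _≢_; refl; sym; ≢-sym)
open import Relation.Nullary.Decidable.Core using (does; map′; ¬?; _×-dec_; _⊎-dec_)
open import Relation.Nullary.Negation.Core using (¬_)

record Graph (n : ℕ) : Set₁ where
  field
    Adj    : Rel (Fin n) 0ℓ
    adj?   : Decidable Adj
    symm   : Symmetric Adj
    irrefl : ∀ {v} → ¬ Adj v v

  Connected : Rel (Fin n) 0ℓ
  Connected = Star Adj

K : (n : ℕ) → Graph n
K n = record
  { Adj    = _≢_
  ; adj?   = λ u v → ¬? (u ≟ᶠ v)
  ; symm   = ≢-sym
  ; irrefl = λ v≢v → v≢v refl
  }

-- Connectivity is decidable, by Warshall's algorithm: Via ws u v says that
-- there is a walk from u to v all of whose interior vertices lie in ws.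
module _ {n : ℕ} (G : Graph n) where
  open Graph G

  Via : List (Fin n) → Rel (Fin n) 0ℓ
  Via []       u v = u ≡ v ⊎ Adj u v
  Via (w ∷ ws) u v = Via ws u v ⊎ (Via ws u w × Via ws w v)

  via? : ∀ ws → Decidable (Via ws)
  via? []       u v = (u ≟ᶠ v) ⊎-dec adj? u v
  via? (w ∷ ws) u v = via? ws u v ⊎-dec (via? ws u w ×-dec via? ws w v)

  via-base : ∀ ws {u v} → u ≡ v ⊎ Adj u v → Via ws u v
  via-base []       p = p
  via-base (w ∷ ws) p = inj₁ (via-base ws p)

  via-trans : ∀ {ws u w v} → w ∈ ws → Via ws u w → Via ws w v → Via ws u v
  via-trans (here refl) p q = inj₂ ([ id , proj₁ ] p , [ id , proj₂ ] q)
  via-trans (there w∈)  (inj₁ p)        (inj₁ q)        = inj₁ (via-trans w∈ p q)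
  via-trans (there w∈)  (inj₁ p)        (inj₂ (q₁ , q₂)) = inj₂ (via-trans w∈ p q₁ , q₂)
  via-trans (there w∈)  (inj₂ (p₁ , p₂)) (inj₁ q)        = inj₂ (p₁ , via-trans w∈ p₂ q)
  via-trans (there _)   (inj₂ (p₁ , _))  (inj₂ (_ , q₂))  = inj₂ (p₁ , q₂)

  via⇒connected : ∀ ws {u v} → Via ws u v → Connected u v
  via⇒connected []       (inj₁ refl)    = ε
  via⇒connected []       (inj₂ e)       = e ◅ ε
  via⇒connected (w ∷ ws) (inj₁ p)       = via⇒connected ws p
  via⇒connected (w ∷ ws) (inj₂ (p , q)) = via⇒connected ws p ◅◅ via⇒connected ws q

  connected⇒via : ∀ {u v} → Connected u v → Via (allFin n) u v
  connected⇒via ε       = via-base (allFin n) (inj₁ refl)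
  connected⇒via (e ◅ p) = via-trans (∈-allFin _) (via-base (allFin n) (inj₂ e)) (connected⇒via p)

  connected? : Decidable Connected
  connected? u v = map′ (via⇒connected (allFin n)) connected⇒via (via? (allFin n) u v)

  component : Fin n → Subset n
  component v = tabulate (λ u → does (connected? v u))

  components : List (Subset n)
  components = deduplicate (≡-decᵛ _≟ᵇ_) (map component (allFin n))

Coloring : ℕ → ℕ → Set
Coloring k n = Vec (Fin k) n

monochromatic : ∀ {k n} → Graph n → Coloring k n → Graph n
monochromatic G c = record
  { Adj    = λ u v → Adj u v × lookup c u ≡ lookup c v
  ; adj?   = λ u v → adj? u v ×-dec (lookup c u ≟ᶠ lookup c v)
  ; symm   = λ (e , eq) → symm e , sym eq
  ; irrefl = irrefl ∘ proj₁
  }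
  where open Graph G

-- Each block is represented by its vertex set.
blocks : ∀ {k n} → Graph n → Coloring k n → List (Subset n)
blocks G c = components (monochromatic G c)

X : (k : ℕ) {n : ℕ} → Graph n → Coloring k n → ℕ
X k G c = length (blocks G c)

colorings : (k n : ℕ) → List (Coloring k n)
colorings k zero    = Vec.[] ∷ []
colorings k (suc n) = cartesianProductWith Vec._∷_ (allFin k) (colorings k n)

uniform : (k : ℕ) .{{_ : NonZero k}} → Fin k → ℚ
uniform k _ = 1ℤ / k

-- The product law, under which the colors of distinct vertices are independent.
ℙ : (k : ℕ) .{{_ : NonZero k}} {n : ℕ} → Coloring k n → ℚ
ℙ k c = Vec.foldr′ _*_ 1ℚ (Vec.map (uniform k) c)

𝔼 : (k : ℕ) .{{_ : NonZero k}} {n : ℕ} → (Coloring k n → ℕ) → ℚ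
𝔼 k {n} Y = foldr _+_ 0ℚ (map (λ c → ℙ k c * (+ Y c / 1)) (colorings k n))

{-# OPTIONS --safe #-}

-- Two distinct vertices of K n are adjacent, so the blocks of a coloring are its
-- color classes and X counts the colors that occur. Hence X c plus the number of
-- colors missing from c is k. A fixed color is missing from (k − 1) ^ n of the
-- k ^ n colorings, so summing over all colorings gives
-- Σ X + k (k − 1) ^ n = k · k ^ n, and dividing by k ^ n gives the expectation.

module Submission where

open import Defs
open import Data.Bool.Base using (true; false)
open import Data.Bool.Properties using () renaming (_≟_ to _≟ᵇ_)
open import Data.Fin.Base using (Fin)
open import Data.Fin.Properties using () renaming (_≟_ to _≟ᶠ_)
open import Data.Integer.Base as ℤ using (+_; 1ℤ)
import Data.Integer.Properties as ℤ
open import Data.List.Base using (List; []; _∷_; [_]; map; foldr; length; filter; allFin; cartesianProductWith; deduplicate)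
open import Data.List.Membership.Propositional using (_∈_)
open import Data.List.Membership.Propositional.Properties using (∈-allFin; ∈-filter⁺; ∈-filter⁻; ∈-map⁺; ∈-map⁻; deduplicate-∈⇔)
open import Data.List.Membership.Propositional.Properties.WithK using (unique∧set⇒bag)
open import Data.List.Properties using (length-map; length-++; length-tabulate; filter-++; map-cong)
open import Data.List.Relation.Binary.BagAndSetEquality using (∼bag⇒↭)
open import Data.List.Relation.Binary.Permutation.Propositional.Properties using (↭-length)
open import Data.List.Relation.Unary.All using ([])
open import Data.List.Relation.Unary.AllPairs using ([]; _∷_)
open import Data.List.Relation.Unary.Any using (here)
open import Data.List.Relation.Unary.Unique.Propositional using (Unique)
open import Data.List.Relation.Unary.Unique.Propositional.Properties using (allFin⁺; filter⁺)
open import Data.List.Relation.Unary.Unique.DecPropositional.Properties using (deduplicate-!)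
open import Data.Nat.Base using (ℕ; zero; suc; _+_; _*_; _∸_; _^_; NonZero)
open import Data.Nat.ListAction using (sum)
open import Data.Nat.Properties using (m^n≢0; +-suc; +-identityʳ; *-comm; *-assoc; *-identityʳ; m*n≢0; m+n∸m≡n; +-commutativeSemigroup)
open import Algebra.Properties.CommutativeSemigroup +-commutativeSemigroup using (interchange; x∙yz≈y∙xz)
open import Data.Product.Base using (_×_; _,_; proj₁; proj₂)
open import Data.Rational.Base as ℚ using (0ℚ; _/_; _-_; toℚᵘ)
import Data.Rational.Properties as ℚ
open import Data.Rational.Unnormalised.Base as ℚᵘ using (mkℚᵘ; *≡*)
import Data.Rational.Unnormalised.Properties as ℚᵘ
open import Data.Vec.Base using ([]; _∷_; lookup)
import Data.Vec.Membership.DecPropositional as DecMembership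
open import Data.Vec.Membership.Propositional using () renaming (_∈_ to _∈ᵛ_; _∉_ to _∉ᵛ_)
open import Data.Vec.Membership.Propositional.Properties using (∈-lookup)
import Data.Vec.Relation.Unary.Any as Any
open import Data.Vec.Relation.Unary.Any.Properties using (lookup-index)
open import Data.Vec.Properties using (tabulate-cong; lookup∘tabulate) renaming (≡-dec to ≡-decᵛ)
open import Function.Base using (_∘_; _on_; it)
open import Function.Bundles using (_⇔_; mk⇔; Equivalence)
open import Relation.Binary.Construct.Closure.ReflexiveTransitive using (ε; _◅_)
open import Relation.Binary.Definitions using (DecidableEquality) renaming (Decidable to Decidable₂)
open import Relation.Binary.PropositionalEquality using (_≡_; _≢_; refl; sym; trans; cong; cong₂; subst; module ≡-Reasoning)
open import Relation.Nullary.Decidable using (Dec; yes; no; does; ¬?; does-⇔; dec-true)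
open import Relation.Nullary.Negation using (¬_; contradiction)
open import Relation.Unary using (Decidable)

open Equivalence using (to; from)

private
  variable
    A B C : Set

-- Filtering and counting

filter-map : ∀ {P : B → Set} {Q : A → Set} (P? : Decidable P) (Q? : Decidable Q) (f : A → B) →
  (∀ x → P (f x) ⇔ Q x) → ∀ xs → filter P? (map f xs) ≡ map f (filter Q? xs)
filter-map P? Q? f P⇔Q []       = refl
filter-map P? Q? f P⇔Q (x ∷ xs)
  -- `filter` branches on `does` alone, so one rewrite makes both filters take the same branch.
  rewrite does-⇔ (P⇔Q x) (P? (f x)) (Q? x) with does (Q? x)
... | true  = cong (f x ∷_) (filter-map P? Q? f P⇔Q xs)
... | false = filter-map P? Q? f P⇔Q xs

¬-cong-⇔ : ∀ {P Q : Set} → P ⇔ Q → (¬ P) ⇔ (¬ Q)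
¬-cong-⇔ P⇔Q = mk⇔ (_∘ from P⇔Q) (_∘ to P⇔Q)

deduplicate-map : ∀ {R : B → B → Set} {S : A → A → Set} (R? : Decidable₂ R) (S? : Decidable₂ S) (f : A → B) →
  (∀ x y → R (f x) (f y) ⇔ S x y) →
  ∀ xs → deduplicate R? (map f xs) ≡ map f (deduplicate S? xs)
deduplicate-map R? S? f R⇔S []       = refl
deduplicate-map R? S? f R⇔S (x ∷ xs) = cong (f x ∷_) (begin
  filter (¬? ∘ R? (f x)) (deduplicate R? (map f xs))
    ≡⟨ cong (filter _) (deduplicate-map R? S? f R⇔S xs) ⟩
  filter (¬? ∘ R? (f x)) (map f (deduplicate S? xs))
    ≡⟨ filter-map _ _ f (λ y → ¬-cong-⇔ (R⇔S x y)) (deduplicate S? xs) ⟩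
  map f (filter (¬? ∘ S? x) (deduplicate S? xs)) ∎)
  where open ≡-Reasoning

-- `f` and `g` have the same kernel. Each side therefore has the length of `xs` deduplicated by that
-- kernel, which is expressed through `g`. This lets colors stand in for components.
length-deduplicate-map : (_≟₁_ : DecidableEquality B) (_≟₂_ : DecidableEquality C) (f : A → B) (g : A → C) →
  (∀ x y → f x ≡ f y ⇔ g x ≡ g y) →
  ∀ xs → length (deduplicate _≟₁_ (map f xs)) ≡ length (deduplicate _≟₂_ (map g xs))
length-deduplicate-map _≟₁_ _≟₂_ f g f⇔g xs = begin
  length (deduplicate _≟₁_ (map f xs)) ≡⟨ cong length (deduplicate-map _≟₁_ S? f f⇔g xs) ⟩
  length (map f (deduplicate S? xs))   ≡⟨ length-map f (deduplicate S? xs) ⟩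
  length (deduplicate S? xs)           ≡⟨ length-map g (deduplicate S? xs) ⟨
  length (map g (deduplicate S? xs))   ≡⟨ cong length (deduplicate-map _≟₂_ S? g (λ _ _ → mk⇔ (λ e → e) (λ e → e)) xs) ⟨
  length (deduplicate _≟₂_ (map g xs)) ∎
  where
  open ≡-Reasoning
  S? : Decidable₂ (_≡_ on g)
  S? x y = g x ≟₂ g y

-- Without repetitions, equal sets are equal multisets, so the lists are permutations of each other.
length-unique : {xs ys : List A} → Unique xs → Unique ys →
  (∀ {z} → z ∈ xs ⇔ z ∈ ys) → length xs ≡ length ys
length-unique xs! ys! eq = ↭-length (∼bag⇒↭ (unique∧set⇒bag xs! ys! eq))

length-filter-∁ : ∀ {P : A → Set} (P? : Decidable P) xs →
  length (filter P? xs) + length (filter (¬? ∘ P?) xs) ≡ length xs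
length-filter-∁ P? []       = refl
length-filter-∁ P? (x ∷ xs) with does (P? x)
... | true  = cong suc (length-filter-∁ P? xs)
... | false = trans (+-suc _ _) (cong suc (length-filter-∁ P? xs))

length-cartesianProductWith : ∀ (f : A → B → C) xs ys →
  length (cartesianProductWith f xs ys) ≡ length xs * length ys
length-cartesianProductWith f []       ys = refl
length-cartesianProductWith f (x ∷ xs) ys = trans (length-++ (map (f x) ys))
  (cong₂ _+_ (length-map (f x) ys) (length-cartesianProductWith f xs ys))

-- The product is a concatenation of rows, one for each `x`. A row contributes a copy of the
-- filtered `ys` if `Q x` holds, and nothing otherwise.
length-filter-cartesianProductWith : ∀ {P : C → Set} {Q : A → Set} {R : B → Set}
  (P? : Decidable P) (Q? : Decidable Q) (R? : Decidable R) (f : A → B → C) →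
  (∀ x y → P (f x y) ⇔ (Q x × R y)) → ∀ xs ys →
  length (filter P? (cartesianProductWith f xs ys)) ≡ length (filter Q? xs) * length (filter R? ys)
length-filter-cartesianProductWith P? Q? R? f P⇔ []       ys = refl
length-filter-cartesianProductWith {P = P} {R = R} P? Q? R? f P⇔ (x ∷ xs) ys
  rewrite filter-++ P? (map (f x) ys) (cartesianProductWith f xs ys)
        | length-++ (filter P? (map (f x) ys)) {filter P? (cartesianProductWith f xs ys)}
        | length-filter-cartesianProductWith P? Q? R? f P⇔ xs ys
  with Q? x
... | yes q = cong (_+ length (filter Q? xs) * length (filter R? ys)) (begin
  length (filter P? (map (f x) ys)) ≡⟨ cong length (filter-map P? R? (f x) P⇔R ys) ⟩
  length (map (f x) (filter R? ys)) ≡⟨ length-map (f x) (filter R? ys) ⟩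
  length (filter R? ys)             ∎)
  where
  open ≡-Reasoning
  P⇔R : ∀ y → P (f x y) ⇔ R y
  P⇔R y = mk⇔ (proj₂ ∘ to (P⇔ x y)) (λ r → from (P⇔ x y) (q , r))
... | no ¬q = cong (_+ length (filter Q? xs) * length (filter R? ys)) (none ys)
  where
  none : ∀ zs → length (filter P? (map (f x) zs)) ≡ 0
  none []       = refl
  none (z ∷ zs) with P? (f x z)
  ... | yes p = contradiction (proj₁ (to (P⇔ x z) p)) ¬q
  ... | no  _ = none zs

-- Sums over lists and double counting

sum-map-+ : ∀ (f g : A → ℕ) xs → sum (map (λ x → f x + g x) xs) ≡ sum (map f xs) + sum (map g xs)
sum-map-+ f g []       = refl
sum-map-+ f g (x ∷ xs) = trans (cong₂ _+_ refl (sum-map-+ f g xs)) (interchange (f x) (g x) _ _)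

sum-map-const : ∀ (f : A → ℕ) m → (∀ x → f x ≡ m) → ∀ xs → sum (map f xs) ≡ length xs * m
sum-map-const f m eq []       = refl
sum-map-const f m eq (x ∷ xs) = cong₂ _+_ (eq x) (sum-map-const f m eq xs)

-- Both sides count the related pairs, by columns and by rows. In the induction on `xs`, `step`
-- splits the row of `x` off every column.
double-count : ∀ {P : A → B → Set} (P? : Decidable₂ P) xs ys →
  sum (map (λ y → length (filter (λ x → P? x y) xs)) ys) ≡ sum (map (λ x → length (filter (P? x) ys)) xs)
double-count P? []       ys = zeros ys
  where
  zeros : ∀ zs → sum (map (λ _ → 0) zs) ≡ 0
  zeros []       = refl
  zeros (_ ∷ zs) = zeros zs
double-count P? (x ∷ xs) ys = trans (step ys) (cong₂ _+_ refl (double-count P? xs ys))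
  where
  step : ∀ zs → sum (map (λ z → length (filter (λ x → P? x z) (x ∷ xs))) zs)
    ≡ length (filter (P? x) zs) + sum (map (λ z → length (filter (λ x → P? x z) xs)) zs)
  step []       = refl
  step (z ∷ zs) with does (P? x z)
  ... | true  = cong suc (trans (cong₂ _+_ refl (step zs)) (x∙yz≈y∙xz (length (filter (λ x → P? x z) xs)) (length (filter (P? x) zs)) _))
  ... | false = trans (cong₂ _+_ refl (step zs)) (x∙yz≈y∙xz (length (filter (λ x → P? x z) xs)) (length (filter (P? x) zs)) _)

-- Blocks of a coloring of the complete graph

_∈?_ : ∀ {k n} (i : Fin k) (c : Coloring k n) → Dec (i ∈ᵛ c)
i ∈? c = DecMembership._∈?_ _≟ᶠ_ i c

module _ {k n : ℕ} (c : Coloring k n) where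

  private
    G = monochromatic (K n) c

  -- The color is constant along a monochromatic walk. Conversely, in a complete graph two vertices
  -- of one color are equal or adjacent, so a walk with at most one edge suffices.
  connected⇔sameColor : ∀ u v → Graph.Connected G u v ⇔ lookup c u ≡ lookup c v
  connected⇔sameColor u v = mk⇔ forth back
    where
    forth : ∀ {u} → Graph.Connected G u v → lookup c u ≡ lookup c v
    forth ε             = refl
    forth ((_ , e) ◅ p) = trans e (forth p)

    back : lookup c u ≡ lookup c v → Graph.Connected G u v
    back e with u ≟ᶠ v
    ... | yes refl = ε
    ... | no u≢v   = (u≢v , e) ◅ ε

  component⇔sameColor : ∀ u v → component G u ≡ component G v ⇔ lookup c u ≡ lookup c v
  component⇔sameColor u v = mk⇔ forth back
    where
    does-connected? : ∀ u w → does (connected? G u w) ≡ does (lookup c u ≟ᶠ lookup c w)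
    does-connected? u w = does-⇔ (connected⇔sameColor u w) (connected? G u w) (lookup c u ≟ᶠ lookup c w)

    back : lookup c u ≡ lookup c v → component G u ≡ component G v
    back e = tabulate-cong λ w → trans (does-connected? u w)
      (trans (cong (λ x → does (x ≟ᶠ lookup c w)) e) (sym (does-connected? v w)))

    -- Both vertex sets are evaluated at `v`, which belongs to its own component by the empty walk.
    forth : component G u ≡ component G v → lookup c u ≡ lookup c v
    forth e = does-true (lookup c u ≟ᶠ lookup c v) (begin
      does (lookup c u ≟ᶠ lookup c v) ≡⟨ does-connected? u v ⟨
      does (connected? G u v)         ≡⟨ lookup∘tabulate _ v ⟨
      lookup (component G u) v        ≡⟨ cong (λ s → lookup s v) e ⟩
      lookup (component G v) v        ≡⟨ lookup∘tabulate _ v ⟩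
      does (connected? G v v)         ≡⟨ dec-true (connected? G v v) ε ⟩
      true                            ∎)
      where
      open ≡-Reasoning
      does-true : ∀ {P : Set} (P? : Dec P) → does P? ≡ true → P
      does-true (yes p) _ = p

  X-K : X k (K n) c ≡ length (filter (_∈? c) (allFin k))
  X-K = begin
    X k (K n) c
      -- Components and colors identify the same pairs of vertices, so distinct blocks can be
      -- counted as distinct colors.
      ≡⟨ length-deduplicate-map (≡-decᵛ _≟ᵇ_) _≟ᶠ_ (component G) (lookup c) component⇔sameColor (allFin n) ⟩
    length (deduplicate _≟ᶠ_ (map (lookup c) (allFin n)))
      ≡⟨ length-unique (deduplicate-! _≟ᶠ_ _) (filter⁺ (_∈? c) (allFin⁺ k)) (mk⇔ forth back) ⟩
    length (filter (_∈? c) (allFin k)) ∎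
    where
    open ≡-Reasoning
    forth : ∀ {i} → i ∈ deduplicate _≟ᶠ_ (map (lookup c) (allFin n)) → i ∈ filter (_∈? c) (allFin k)
    forth i∈ with ∈-map⁻ (lookup c) (from (deduplicate-∈⇔ _≟ᶠ_) i∈)
    ... | v , _ , refl = ∈-filter⁺ (_∈? c) (∈-allFin _) (∈-lookup v c)

    back : ∀ {i} → i ∈ filter (_∈? c) (allFin k) → i ∈ deduplicate _≟ᶠ_ (map (lookup c) (allFin n))
    back i∈ = to (deduplicate-∈⇔ _≟ᶠ_) (subst (_∈ _) (sym (lookup-index i∈c)) (∈-map⁺ (lookup c) (∈-allFin _)))
      where i∈c = proj₂ (∈-filter⁻ (_∈? c) {xs = allFin k} i∈)

-- Counting colorings

length-allFin : ∀ k → length (allFin k) ≡ k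
length-allFin k = length-tabulate {n = k} (λ i → i)

length-colorings : ∀ k n → length (colorings k n) ≡ k ^ n
length-colorings k zero    = refl
length-colorings k (suc n) = trans
  (length-cartesianProductWith _∷_ (allFin k) (colorings k n))
  (cong₂ _*_ (length-allFin k) (length-colorings k n))

-- The colors equal to `i` form a duplicate-free list with the members of `[ i ]`, hence of length
-- 1. The complementary filter keeps the rest of the `k` colors.
otherColors : ∀ {k} (i : Fin k) → length (filter (¬? ∘ (i ≟ᶠ_)) (allFin k)) ≡ k ∸ 1
otherColors {k} i = begin
  others                            ≡⟨ m+n∸m≡n 1 others ⟨
  1 + others ∸ 1                    ≡⟨ cong (λ m → m + others ∸ 1) (length-unique singleton! (filter⁺ (i ≟ᶠ_) (allFin⁺ k)) (mk⇔ forth back)) ⟩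
  length (filter (i ≟ᶠ_) (allFin k)) + others ∸ 1 ≡⟨ cong (_∸ 1) (length-filter-∁ (i ≟ᶠ_) (allFin k)) ⟩
  length (allFin k) ∸ 1             ≡⟨ cong (_∸ 1) (length-allFin k) ⟩
  k ∸ 1                             ∎
  where
  open ≡-Reasoning
  others = length (filter (¬? ∘ (i ≟ᶠ_)) (allFin k))

  singleton! : Unique [ i ]
  singleton! = [] ∷ []

  forth : ∀ {j} → j ∈ [ i ] → j ∈ filter (i ≟ᶠ_) (allFin k)
  forth (here refl) = ∈-filter⁺ (i ≟ᶠ_) (∈-allFin i) refl

  back : ∀ {j} → j ∈ filter (i ≟ᶠ_) (allFin k) → j ∈ [ i ]
  back j∈ = here (sym (proj₂ (∈-filter⁻ (i ≟ᶠ_) {xs = allFin k} j∈)))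

-- A coloring avoids `i` exactly when its head and its tail do, so each vertex contributes an
-- independent factor `k ∸ 1`.
colorings-avoiding : ∀ {k} n (i : Fin k) →
  length (filter (λ c → ¬? (i ∈? c)) (colorings k n)) ≡ (k ∸ 1) ^ n
colorings-avoiding     zero    i = refl
colorings-avoiding {k} (suc n) i = trans
  (length-filter-cartesianProductWith (λ c → ¬? (i ∈? c)) (¬? ∘ (i ≟ᶠ_)) (λ c → ¬? (i ∈? c)) _∷_ ∉-∷ (allFin k) (colorings k n))
  (cong₂ _*_ (otherColors i) (colorings-avoiding n i))
  where
  ∉-∷ : ∀ x (c : Coloring k n) → i ∉ᵛ (x ∷ c) ⇔ (i ≢ x × i ∉ᵛ c)
  ∉-∷ x c = mk⇔ (λ i∉ → i∉ ∘ Any.here , i∉ ∘ Any.there)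
    λ { (i≢x , i∉c) (Any.here i≡x) → i≢x i≡x ; (i≢x , i∉c) (Any.there i∈c) → i∉c i∈c }

sum-X-K : ∀ k n → sum (map (X k (K n)) (colorings k n)) + k * (k ∸ 1) ^ n ≡ k ^ n * k
sum-X-K k n = begin
  sum (map (X k (K n)) cs) + k * (k ∸ 1) ^ n
    ≡⟨ cong₂ (λ s l → s + l * (k ∸ 1) ^ n) (cong sum (map-cong X-K cs)) (sym (length-allFin k)) ⟩
  sum (map used cs) + length (allFin k) * (k ∸ 1) ^ n
    -- The product becomes a sum over colors `i` of the number of colorings that miss `i`; the next
    -- step exchanges the order of counting.
    ≡⟨ cong₂ _+_ refl (sum-map-const _ _ (colorings-avoiding n) (allFin k)) ⟨
  sum (map used cs) + sum (map (λ i → length (filter (λ c → ¬? (i ∈? c)) cs)) (allFin k))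
    ≡⟨ cong₂ _+_ refl (double-count (λ i c → ¬? (i ∈? c)) (allFin k) cs) ⟨
  sum (map used cs) + sum (map missing cs)
    ≡⟨ sum-map-+ used missing cs ⟨
  sum (map (λ c → used c + missing c) cs)
    -- In each coloring the used and the missing colors together make up all `k`.
    ≡⟨ sum-map-const _ k (λ c → trans (length-filter-∁ (_∈? c) (allFin k)) (length-allFin k)) cs ⟩
  length cs * k
    ≡⟨ cong (_* k) (length-colorings k n) ⟩
  k ^ n * k ∎
  where
  open ≡-Reasoning
  cs = colorings k n
  used missing : Coloring k n → ℕ
  used    c = length (filter (_∈? c) (allFin k))
  missing c = length (filter (λ i → ¬? (i ∈? c)) (allFin k))

-- Fractions of natural numbers

/-cong-* : ∀ a b m n .{{_ : NonZero m}} .{{_ : NonZero n}} → a * n ≡ b * m → + a / m ≡ + b / n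
/-cong-* a b m@(suc _) n@(suc _) eq = ℚ.fromℚᵘ-cong {mkℚᵘ (+ a) _} {mkℚᵘ (+ b) _}
  (*≡* (trans (sym (ℤ.pos-* a n)) (trans (cong +_ eq) (ℤ.pos-* b m))))

-- The computation passes to unnormalised fractions, where multiplication acts on numerators and
-- denominators without reducing to lowest terms.
/-*-/ : ∀ a b m n .{{_ : NonZero m}} .{{_ : NonZero n}} →
  (+ a / m) ℚ.* (+ b / n) ≡ _/_ (+ (a * b)) (m * n) {{m*n≢0 m n}}
/-*-/ a b m@(suc m-1) n@(suc n-1) = ℚ.toℚᵘ-injective (begin
  toℚᵘ ((+ a / m) ℚ.* (+ b / n))       ≈⟨ ℚ.toℚᵘ-homo-* (+ a / m) (+ b / n) ⟩
  toℚᵘ (+ a / m) ℚᵘ.* toℚᵘ (+ b / n)   ≈⟨ ℚᵘ.*-cong (ℚ.toℚᵘ-fromℚᵘ p) (ℚ.toℚᵘ-fromℚᵘ q) ⟩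
  p ℚᵘ.* q                             ≈⟨ ℚᵘ.≃-reflexive (cong (λ z → mkℚᵘ z _) (sym (ℤ.pos-* a b))) ⟩
  mkℚᵘ (+ (a * b)) _                   ≈⟨ ℚ.toℚᵘ-fromℚᵘ (mkℚᵘ (+ (a * b)) _) ⟨
  toℚᵘ (+ (a * b) / (m * n))           ∎)
  where
  open ℚᵘ.≃-Reasoning
  p = mkℚᵘ (+ a) m-1
  q = mkℚᵘ (+ b) n-1

/-+-/ : ∀ a b m .{{_ : NonZero m}} → (+ a / m) ℚ.+ (+ b / m) ≡ + (a + b) / m
/-+-/ a b m@(suc m-1) = ℚ.toℚᵘ-injective (begin
  toℚᵘ ((+ a / m) ℚ.+ (+ b / m))       ≈⟨ ℚ.toℚᵘ-homo-+ (+ a / m) (+ b / m) ⟩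
  toℚᵘ (+ a / m) ℚᵘ.+ toℚᵘ (+ b / m)   ≈⟨ ℚᵘ.+-cong (ℚ.toℚᵘ-fromℚᵘ p) (ℚ.toℚᵘ-fromℚᵘ q) ⟩
  -- Unnormalised addition yields the denominator `m * m`; cross-multiplication cancels the extra
  -- factor `m`.
  p ℚᵘ.+ q                             ≈⟨ *≡* (trans (cong (ℤ._* + m) (sym (ℤ.*-distribʳ-+ (+ m) (+ a) (+ b)))) (ℤ.*-assoc (+ a ℤ.+ + b) (+ m) (+ m))) ⟩
  mkℚᵘ (+ (a + b)) m-1                 ≈⟨ ℚ.toℚᵘ-fromℚᵘ (mkℚᵘ (+ (a + b)) m-1) ⟨
  toℚᵘ (+ (a + b) / m)                 ∎)
  where
  open ℚᵘ.≃-Reasoning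
  p = mkℚᵘ (+ a) m-1
  q = mkℚᵘ (+ b) m-1

-- The expectation as an average over colorings

ℙ-uniform : ∀ k n .{{_ : NonZero k}} (c : Coloring k n) → ℙ k c ≡ _/_ 1ℤ (k ^ n) {{m^n≢0 k n}}
ℙ-uniform k zero    []      = refl
ℙ-uniform k (suc n) (x ∷ c) = trans (cong ((1ℤ / k) ℚ.*_) (ℙ-uniform k n c)) (/-*-/ 1 1 k (k ^ n) {{it}} {{m^n≢0 k n}})

-- All colorings have the same weight, one over `k ^ n`, so every term is a fraction with this
-- denominator and the numerators add up.
𝔼-average : ∀ k n .{{_ : NonZero k}} (Y : Coloring k n → ℕ) →
  𝔼 k Y ≡ _/_ (+ sum (map Y (colorings k n))) (k ^ n) {{m^n≢0 k n}}
𝔼-average k n Y = go (colorings k n)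
  where
  instance _ = m^n≢0 k n
  open ≡-Reasoning

  term : ∀ c → ℙ k c ℚ.* (+ Y c / 1) ≡ + Y c / (k ^ n)
  term c = begin
    ℙ k c ℚ.* (+ Y c / 1)              ≡⟨ cong (ℚ._* (+ Y c / 1)) (ℙ-uniform k n c) ⟩
    (1ℤ / (k ^ n)) ℚ.* (+ Y c / 1)     ≡⟨ /-*-/ 1 (Y c) (k ^ n) 1 ⟩
    _/_ (+ (1 * Y c)) (k ^ n * 1) {{m*n≢0 (k ^ n) 1}}
      -- `1 * Y c` unfolds to `Y c + 0`, hence `+-identityʳ`.
      ≡⟨ ℚ./-cong {{m*n≢0 (k ^ n) 1}} (cong +_ (+-identityʳ (Y c))) (*-identityʳ (k ^ n)) ⟩
    + Y c / (k ^ n)                    ∎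

  go : ∀ cs → foldr ℚ._+_ 0ℚ (map (λ c → ℙ k c ℚ.* (+ Y c / 1)) cs) ≡ + sum (map Y cs) / (k ^ n)
  -- The empty sum is zero over 1 and has to be matched with zero over `k ^ n`.
  go []       = /-cong-* 0 0 1 (k ^ n) refl
  go (c ∷ cs) = trans (cong₂ ℚ._+_ (term c) (go cs)) (/-+-/ (Y c) (sum (map Y cs)) (k ^ n))

p+q≡r⇒p≡r-q : ∀ p q r → p ℚ.+ q ≡ r → p ≡ r - q
p+q≡r⇒p≡r-q p q .(p ℚ.+ q) refl = begin
  p                     ≡⟨ ℚ.+-identityʳ p ⟨
  p ℚ.+ 0ℚ              ≡⟨ cong (p ℚ.+_) (ℚ.+-inverseʳ q) ⟨
  p ℚ.+ (q - q)         ≡⟨ ℚ.+-assoc p q (ℚ.- q) ⟨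
  (p ℚ.+ q) - q         ∎
  where open ≡-Reasoning

corollary4p2 : (k n : ℕ) .{{_ : NonZero k}} .{{_ : NonZero n}} →
    𝔼 k (X k (K n)) ≡ + k / 1 - _/_ (+ ((k ∸ 1) ^ n)) (k ^ (n ∸ 1)) {{m^n≢0 k (n ∸ 1)}}
corollary4p2 k n@(suc m) = trans (𝔼-average k n (X k (K n))) (p+q≡r⇒p≡r-q _ _ _ (begin
  -- The subtracted term is moved to the left side and expanded by `k`, giving both fractions the
  -- denominator `k ^ n`. The count `sum-X-K` then evaluates the joint numerator as `k ^ n * k`.
  (+ S / (k ^ n)) ℚ.+ (+ M / (k ^ m))         ≡⟨ cong ((+ S / (k ^ n)) ℚ.+_) (/-cong-* M (k * M) (k ^ m) (k ^ n) cross) ⟩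
  (+ S / (k ^ n)) ℚ.+ (+ (k * M) / (k ^ n))   ≡⟨ /-+-/ S (k * M) (k ^ n) ⟩
  + (S + k * M) / (k ^ n)                     ≡⟨ /-cong-* (S + k * M) k (k ^ n) 1 (trans (*-identityʳ _) (trans (sum-X-K k n) (*-comm (k ^ n) k))) ⟩
  + k / 1                                     ∎))
  where
  open ≡-Reasoning
  instance
    _ = m^n≢0 k m
    _ = m^n≢0 k n
  S = sum (map (X k (K n)) (colorings k n))
  M = (k ∸ 1) ^ n

  cross : M * k ^ n ≡ k * M * k ^ m
  cross = trans (sym (*-assoc M k (k ^ m))) (cong (_* k ^ m) (*-comm M k))
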